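{- $\mathrm{nM}([2]) = \mathrm{nM}(\mathrm{N}) = \mathrm{N}$, where $[2]$ denotes the function $f : \mathbb{N} \to \mathbb{N}\cup\{+\infty\}$ with $f(1) = 2$ and $f(k) = +\infty$ for $k \ge 2$.
   Context: $\mathrm{N} : \mathbb{N} \to \mathbb{N}$ is defined by $\mathrm{N}(1) = 2$ and $\mathrm{N}(k) = \max_{i \in \{2,\dots,k\}} \min(2i, \mathrm{N}(k-i+1)+i)$ for $k \ge 2$. For a function $g : \mathbb{N} \to \mathbb{N} \cup \{+\infty\}$ and $k \ge 2$, $m \ge 4$, let $\mathrm{pdp}_g(k,m)$ be the set of pairs $(e_0,e_1) \in \mathbb{N}^2$ with (i) $e_0, e_1 \ge 2$; (ii) $e_0, e_1 \le k$; (iii) $e_0 + e_1 = m$; (iv) $e_0 \le e_1$; (v) $g(k - e_\varepsilon + 1) + e_\varepsilon \ge m$ for both $\varepsilon \in \{0,1\}$ (this only depends on the values $g(k')$ for $k' < k$). For $f : \mathbb{N} \to \mathbb{N} \cup \{+\infty\}$ with $f(1) = 2$, the function $f' = \mathrm{nM}(f)$ is defined recursively: $f'(1) = 2$, and for $k > 1$, with $m$ the largest integer in $\{4, \dots, 2k\}$ such that $\mathrm{pdp}_{f'}(k,m) \ne \emptyset$ (using the already defined values $f'(k')$, $k' < k$; note $(2,2) \in \mathrm{pdp}_{f'}(k,4)$), set $f'(k) = \min(m, f(k))$. -}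

module Defs where

open import Data.List.Base using (List; applyUpTo; filter; map)
open import Data.List.Extrema.Nat using (max; argmax-sel; xs≤max)
open import Data.List.Membership.Propositional using (_∈_)
open import Data.List.Membership.Propositional.Properties
  using (∈-applyUpTo⁺; ∈-applyUpTo⁻; ∈-filter⁺; ∈-filter⁻)
open import Data.List.Properties using (filter-≐; map-cong-local)
open import Data.List.Relation.Unary.All as All using ()
open import Data.Maybe.Base as Maybe using ()
open import Data.Nat.Base using (ℕ; zero; suc; _+_; _*_; _∸_; _⊓_; _≤_; _<_; s≤s)
open import Data.Nat.Properties
open import Data.Product.Base using (∃; _×_; _,_; proj₁; proj₂)
open import Data.Sum.Base using (inj₁; inj₂)
open import Function.Base using (id)
open import Level using (0ℓ)
open import Relation.Binary.Construct.Add.Supremum.NonStrict _≤_ using (_≤⁺_; ≤⁺-dec)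
open import Relation.Binary.PropositionalEquality
  using (_≡_; refl; sym; cong; subst)
open import Relation.Nullary.Construct.Add.Supremum using (_⁺; [_]; ⊤⁺)
open import Relation.Nullary.Decidable using (map′; _×-dec_)
open import Relation.Unary using (Pred; Decidable)

ℕ∞ : Set
ℕ∞ = ℕ ⁺

infixl 6 _+∞_
_+∞_ : ℕ∞ → ℕ → ℕ∞
x +∞ e = Maybe.map (_+ e) x

infixl 7 _⊓∞_
_⊓∞_ : ℕ → ℕ∞ → ℕ∞
m ⊓∞ [ n ] = [ m ⊓ n ]
m ⊓∞ ⊤⁺    = [ m ]

-- The integers a, a + 1, …, b.
range : ℕ → ℕ → List ℕ
range a b = applyUpTo (a +_) (suc b ∸ a)

-- Recursion in which the value at k may use all the values below k: when
-- step g k depends only on the values of g below k, recursive step is the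
-- function h with h k ≡ step h k for all k (see recursive-unfold).  The
-- argument default is then irrelevant.
module CourseOfValues {A : Set} (default : A) (step : (ℕ → A) → ℕ → A) where

  approx : ℕ → ℕ → A
  approx zero    = λ _ → default
  approx (suc n) = step (approx n)

  recursive : ℕ → A
  recursive k = approx (suc k) k

  module _ (local : ∀ {g h} k → (∀ {j} → j < k → g j ≡ h j) → step g k ≡ step h k) where

    approx-stable : ∀ {n p} k → k < n → k < p → approx n k ≡ approx p k
    approx-stable {suc n} {suc p} k (s≤s k≤n) (s≤s k≤p) = local k λ j<k →
      approx-stable _ (<-≤-trans j<k k≤n) (<-≤-trans j<k k≤p)

    recursive-unfold : ∀ k → recursive k ≡ step recursive k
    recursive-unfold k = local k λ {j} j<k → approx-stable j j<k ≤-refl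

-- All functions below are meant on positive integers; the values at 0 are
-- arbitrary and never enter the values at positive arguments.

-- The 0 in max is neutral: it only serves to make max total on lists.
N-step : (ℕ → ℕ) → ℕ → ℕ
N-step g 0               = 0
N-step g 1               = 2
N-step g k@(suc (suc _)) = max 0 (map (λ i → (2 * i) ⊓ (g (k ∸ i + 1) + i)) (range 2 k))

N : ℕ → ℕ
N = CourseOfValues.recursive 0 N-step

pdp : (ℕ → ℕ∞) → ℕ → ℕ → Pred (ℕ × ℕ) 0ℓ
pdp g k m (e₀ , e₁) =
  (2 ≤ e₀ × 2 ≤ e₁) ×
  (e₀ ≤ k × e₁ ≤ k) ×
  e₀ + e₁ ≡ m ×
  e₀ ≤ e₁ ×
  ([ m ] ≤⁺ g (k ∸ e₀ + 1) +∞ e₀ × [ m ] ≤⁺ g (k ∸ e₁ + 1) +∞ e₁)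

pdp? : ∀ g k m → Decidable (pdp g k m)
pdp? g k m (e₀ , e₁) =
  (2 ≤? e₀ ×-dec 2 ≤? e₁) ×-dec
  (e₀ ≤? k ×-dec e₁ ≤? k) ×-dec
  e₀ + e₁ ≟ m ×-dec
  e₀ ≤? e₁ ×-dec
  (≤⁺-dec _≤?_ _ _ ×-dec ≤⁺-dec _≤?_ _ _)

pdp-nonempty? : ∀ g k → Decidable (λ m → ∃ (pdp g k m))
pdp-nonempty? g k m = map′
  (λ (e₀ , _ , e₁ , _ , p) → (e₀ , e₁) , p)
  (λ ((e₀ , e₁) , p@(_ , (e₀≤k , e₁≤k) , _)) → e₀ , s≤s e₀≤k , e₁ , s≤s e₁≤k , p)
  (anyUpTo? (λ e₀ → anyUpTo? (λ e₁ → pdp? g k m (e₀ , e₁)) (suc k)) (suc k))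

-- The largest m in {4, …, 2k} with pdp g k m nonempty.  The default 4 only
-- matters when there is no such m, which is excluded as soon as (2 , 2)
-- belongs to pdp g k 4 (see largest-isLargest).
largest : (ℕ → ℕ∞) → ℕ → ℕ
largest g k = max 4 (filter (pdp-nonempty? g k) (range 4 (2 * k)))

nM-step : (ℕ → ℕ∞) → (ℕ → ℕ∞) → ℕ → ℕ∞
nM-step f g 0               = ⊤⁺
nM-step f g 1               = [ 2 ]
nM-step f g k@(suc (suc _)) = largest g k ⊓∞ f k

nM : (ℕ → ℕ∞) → ℕ → ℕ∞
nM f = CourseOfValues.recursive ⊤⁺ (nM-step f)

[2] : ℕ → ℕ∞
[2] 1 = [ 2 ]
[2] _ = ⊤⁺

N∞ : ℕ → ℕ∞
N∞ k = [ N k ]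

∈-range⁺ : ∀ {a b i} → a ≤ i → i ≤ b → i ∈ range a b
∈-range⁺ {a} {b} {i} a≤i i≤b = subst (_∈ range a b) (m+[n∸m]≡n a≤i)
  (∈-applyUpTo⁺ (a +_) (∸-monoˡ-< (s≤s i≤b) a≤i))

∈-range⁻ : ∀ {a b i} → i ∈ range a b → a ≤ i × i ≤ b
∈-range⁻ {a} {b} i∈ with ∈-applyUpTo⁻ (a +_) i∈
... | j , j< , refl = m≤m+n a j , ≤-pred (subst (_≤ suc b) (+-suc a j)
  (subst (a + suc j ≤_) (m+[n∸m]≡n a≤1+b) (+-monoʳ-≤ a j<)))
  where
  a≤1+b : a ≤ suc b
  a≤1+b = <⇒≤ (m∸n≢0⇒n<m λ eq → n≮0 (subst (j <_) eq j<))

k∸e+1<k : ∀ {k e} → 2 ≤ e → e ≤ k → k ∸ e + 1 < k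
k∸e+1<k {k} {e} 2≤e e≤k = subst (k ∸ e + 1 <_) (m∸n+n≡m e≤k) (+-monoʳ-< (k ∸ e) 2≤e)

N-step-local : ∀ {g h} k → (∀ {j} → j < k → g j ≡ h j) → N-step g k ≡ N-step h k
N-step-local 0 _ = refl
N-step-local 1 _ = refl
N-step-local k@(suc (suc _)) eq = cong (max 0) (map-cong-local (All.tabulate λ {i} i∈ →
  let 2≤i , i≤k = ∈-range⁻ {2} {k} i∈ in
  cong (λ x → (2 * i) ⊓ (x + i)) (eq (k∸e+1<k 2≤i i≤k))))

pdp-local : ∀ {g h} k m → (∀ {j} → j < k → g j ≡ h j) → ∀ {e} → pdp g k m e → pdp h k m e
pdp-local k m eq {e₀ , e₁} (p@(2≤e₀ , 2≤e₁) , q@(e₀≤k , e₁≤k) , r , s , t₀ , t₁) =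
  p , q , r , s ,
  subst (λ x → [ m ] ≤⁺ x +∞ e₀) (eq (k∸e+1<k 2≤e₀ e₀≤k)) t₀ ,
  subst (λ x → [ m ] ≤⁺ x +∞ e₁) (eq (k∸e+1<k 2≤e₁ e₁≤k)) t₁

nM-step-local : ∀ f {g h} k → (∀ {j} → j < k → g j ≡ h j) → nM-step f g k ≡ nM-step f h k
nM-step-local f 0 _ = refl
nM-step-local f 1 _ = refl
nM-step-local f {g} {h} k@(suc (suc _)) eq = cong (λ ms → max 4 ms ⊓∞ f k)
  (filter-≐ (pdp-nonempty? g k) (pdp-nonempty? h k)
    ( (λ {m} (e , p) → e , pdp-local k m eq p)
    , (λ {m} (e , p) → e , pdp-local k m (λ j<k → sym (eq j<k)) p))
    (range 4 (2 * k)))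

N-unfold : ∀ k → N k ≡ N-step N k
N-unfold = CourseOfValues.recursive-unfold 0 N-step N-step-local

nM-unfold : ∀ f k → nM f k ≡ nM-step f (nM f) k
nM-unfold f = CourseOfValues.recursive-unfold ⊤⁺ (nM-step f) (nM-step-local f)

largest-isLargest : ∀ g k → 2 ≤ k → ∃ (pdp g k 4) →
  let m = largest g k in
  (4 ≤ m × m ≤ 2 * k) × ∃ (pdp g k m) ×
  (∀ m′ → 4 ≤ m′ → m′ ≤ 2 * k → ∃ (pdp g k m′) → m′ ≤ m)
largest-isLargest g k 2≤k p₄ = ∈-range⁻ (proj₁ m∈) , proj₂ m∈ , λ m′ 4≤m′ m′≤2k p →
  All.lookup (xs≤max 4 ms) (∈-filter⁺ (pdp-nonempty? g k) (∈-range⁺ 4≤m′ m′≤2k) p)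
  where
  ms : List ℕ
  ms = filter (pdp-nonempty? g k) (range 4 (2 * k))
  m∈ : largest g k ∈ range 4 (2 * k) × ∃ (pdp g k (largest g k))
  m∈ with argmax-sel id 4 ms
  ... | inj₂ m∈ms = ∈-filter⁻ (pdp-nonempty? g k) m∈ms
  ... | inj₁ m≡4  = subst (λ m → m ∈ range 4 (2 * k) × ∃ (pdp g k m)) (sym m≡4)
    (∈-range⁺ ≤-refl (*-monoʳ-≤ 2 2≤k) , p₄)

{-# OPTIONS --safe #-}
-- In a pair (e₀ , e₁) of pdp with e₀ ≤ e₁, the sum e₀ + e₁ is at most the term of index e₁
-- in the maximum defining N k.  Conversely, if the maximum is attained at i, then the pair
-- (N (k - i + 1) ⊓ i , i) has sum N k; its one nontrivial constraint holds because N is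
-- strictly increasing, so that N (a + d) ≥ N a + d.
module Submission where

open import Defs
open import Data.List.Base using (map)
open import Data.List.Extrema.Nat using (max; argmax-sel; xs≤max)
open import Data.List.Membership.Propositional.Properties using (∈-map⁺; ∈-map⁻)
open import Data.List.Relation.Unary.All as All using ()
open import Data.Nat.Base using (ℕ; zero; suc; _+_; _*_; _∸_; _⊓_; _≤_; _<_; z≤n; s≤s)
open import Data.Nat.Induction using (<-rec)
open import Data.Nat.Properties
open import Data.Product.Base using (∃; _×_; _,_; proj₁; proj₂)
open import Data.Sum.Base using (inj₁; inj₂)
open import Function.Base using (id)
open import Relation.Binary.Construct.Add.Supremum.NonStrict _≤_ using (_≤⁺_; [_])
open import Relation.Binary.PropositionalEquality
  using (_≡_; refl; sym; trans; cong; subst; subst₂)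
open import Relation.Nullary.Construct.Add.Supremum using () renaming ([_] to [_]⁺)
open import Relation.Nullary.Negation using (contradiction)

N-term : ℕ → ℕ → ℕ
N-term k i = (2 * i) ⊓ (N (k ∸ i + 1) + i)

N≡max : ∀ {k} → 2 ≤ k → N k ≡ max 0 (map (N-term k) (range 2 k))
N≡max {suc zero} (s≤s ())
N≡max {k@(suc (suc _))} _ = N-unfold k

N-term≤N : ∀ {k i} → 2 ≤ i → i ≤ k → N-term k i ≤ N k
N-term≤N {k} {i} 2≤i i≤k = subst (N-term k i ≤_) (sym (N≡max (≤-trans 2≤i i≤k)))
  (All.lookup (xs≤max 0 (map (N-term k) (range 2 k)))
    (∈-map⁺ (N-term k) {x = i} (∈-range⁺ 2≤i i≤k)))

2≤N : ∀ {k} → 1 ≤ k → 2 ≤ N k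
2≤N {k} 1≤k with m≤n⇒m<n∨m≡n 1≤k
... | inj₂ refl = ≤-refl
-- Both arguments of the minimum in the term of index 2 are at least 2.
... | inj₁ 2≤k  = ≤-trans (⊓-glb (m≤m+n 2 2) (m≤n+m 2 (N (k ∸ 2 + 1)))) (N-term≤N {k} {2} ≤-refl 2≤k)

N-attained : ∀ k → 2 ≤ k → ∃ λ i → 2 ≤ i × i ≤ k × N k ≡ N-term k i
N-attained k 2≤k with argmax-sel id 0 (map (N-term k) (range 2 k))
-- The maximum is not the default 0, since `N k` is at least 2.
... | inj₁ max≡0 = contradiction
  (subst (2 ≤_) (trans (N≡max 2≤k) max≡0) (2≤N (<⇒≤ 2≤k))) n≮0
... | inj₂ max∈ with ∈-map⁻ (N-term k) {xs = range 2 k} max∈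
...   | i , i∈ , max≡ =
  i , proj₁ (∈-range⁻ {2} {k} i∈) , proj₂ (∈-range⁻ {2} {k} i∈) , trans (N≡max 2≤k) max≡

-- If `N k` is attained at `i`, pass to the term of index `suc i` for `suc k`: the difference
-- `k ∸ i` is unchanged, so both arguments of the minimum grow strictly.
N-suc : ∀ k → 1 ≤ k → N k < N (suc k)
N-suc k 1≤k with m≤n⇒m<n∨m≡n 1≤k
-- By computation `N 1` is 2 and `N 2` is 4.
... | inj₂ refl = m≤m+n 3 1
... | inj₁ 2≤k with N-attained k 2≤k
...   | i , 2≤i , i≤k , Nk≡ = begin-strict
  N k                    ≡⟨ Nk≡ ⟩
  N-term k i             <⟨ ⊓-mono-< (*-monoʳ-< 2 (n<1+n i))
                              (+-monoʳ-< (N (k ∸ i + 1)) (n<1+n i)) ⟩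
  N-term (suc k) (suc i) ≤⟨ N-term≤N (m≤n⇒m≤1+n 2≤i) (s≤s i≤k) ⟩
  N (suc k)              ∎
  where open ≤-Reasoning

N-+ : ∀ {k} → 1 ≤ k → ∀ d → N k + d ≤ N (k + d)
N-+ {k} 1≤k zero = ≤-reflexive (trans (+-identityʳ (N k)) (cong N (sym (+-identityʳ k))))
N-+ {k} 1≤k (suc d) = begin
  N k + suc d     ≡⟨ +-suc (N k) d ⟩
  suc (N k + d)   ≤⟨ s≤s (N-+ 1≤k d) ⟩
  suc (N (k + d)) ≤⟨ N-suc (k + d) (≤-trans 1≤k (m≤m+n k d)) ⟩
  N (suc (k + d)) ≡⟨ cong N (+-suc k d) ⟨
  N (k + suc d)   ∎
  where open ≤-Reasoning

-- From `e₀ ≤ e₁` the sum is at most `2 * e₁`; the constraint at `e₁` bounds it by the other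
-- argument of `N-term k e₁`.
pdp-N⇒≤N : ∀ {k m} → ∃ (pdp N∞ k m) → m ≤ N k
pdp-N⇒≤N {k} ((e₀ , e₁) , (_ , 2≤e₁) , (_ , e₁≤k) , refl , e₀≤e₁ , _ , [ m≤ ]) =
  ≤-trans (⊓-glb m≤2e₁ m≤) (N-term≤N 2≤e₁ e₁≤k)
  where
  m≤2e₁ : e₀ + e₁ ≤ 2 * e₁
  m≤2e₁ = ≤-trans (+-monoˡ-≤ e₁ e₀≤e₁) (+-monoʳ-≤ e₁ (m≤m+n e₁ 0))

-- With j = k - i + 1 and e = N j ⊓ i, the bound N (k - e + 1) ≥ i is the inequality
-- N (j + d) ≥ N j + d for d = i - e.
pdp-N-N : ∀ k → 2 ≤ k → ∃ (pdp N∞ k (N k))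
pdp-N-N k 2≤k with N-attained k 2≤k
... | i , 2≤i , i≤k , Nk≡ =
  (e , i) , (2≤e , 2≤i) , (≤-trans e≤i i≤k , i≤k) , e+i≡Nk , e≤i ,
  [ subst (_≤ N (k ∸ e + 1) + e) e+i≡Nk
      (subst (_≤ N (k ∸ e + 1) + e) (+-comm i e) (+-monoˡ-≤ e i≤N)) ] ,
  [ subst (_≤ N j + i) e+i≡Nk (+-monoˡ-≤ i (m⊓n≤m (N j) i)) ]
  where
  open ≤-Reasoning
  j e d : ℕ
  j = k ∸ i + 1
  e = N j ⊓ i
  d = i ∸ e
  1≤j : 1 ≤ j
  1≤j = m≤n+m 1 (k ∸ i)
  e≤i : e ≤ i
  e≤i = m⊓n≤n (N j) i
  2≤e : 2 ≤ e
  2≤e = ⊓-glb (2≤N 1≤j) 2≤i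
  e+i≡Nk : e + i ≡ N k
  -- Adding `i` distributes over the minimum `N j ⊓ i` and gives the term of index `i`.
  e+i≡Nk = begin-equality
    e + i                 ≡⟨ +-distribʳ-⊓ i (N j) i ⟩
    (N j + i) ⊓ (i + i)   ≡⟨ ⊓-comm (N j + i) (i + i) ⟩
    (i + i) ⊓ (N j + i)   ≡⟨ cong (λ x → (i + x) ⊓ (N j + i)) (+-identityʳ i) ⟨
    N-term k i            ≡⟨ Nk≡ ⟨
    N k                   ∎
  j+d≡ : j + d ≡ k ∸ e + 1
  j+d≡ = begin-equality
    k ∸ i + 1 + d     ≡⟨ +-assoc (k ∸ i) 1 d ⟩
    k ∸ i + (1 + d)   ≡⟨ cong (k ∸ i +_) (+-comm 1 d) ⟩
    k ∸ i + (d + 1)   ≡⟨ +-assoc (k ∸ i) d 1 ⟨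
    k ∸ i + d + 1     ≡⟨ cong (_+ 1) (+-∸-assoc (k ∸ i) e≤i) ⟨
    k ∸ i + i ∸ e + 1 ≡⟨ cong (λ x → x ∸ e + 1) (m∸n+n≡m i≤k) ⟩
    k ∸ e + 1         ∎
  i≤N : i ≤ N (k ∸ e + 1)
  i≤N = begin
    i             ≡⟨ m+[n∸m]≡n e≤i ⟨
    e + d         ≤⟨ +-monoˡ-≤ d (m⊓n≤m (N j) i) ⟩
    N j + d       ≤⟨ N-+ 1≤j d ⟩
    N (j + d)     ≡⟨ cong N j+d≡ ⟩
    N (k ∸ e + 1) ∎

-- Unlike pdp-local, this does not compare the values at 0, where nM f and N∞ differ.
pdp-local⁺ : ∀ {g h} k m → (∀ {j} → 1 ≤ j → j < k → g j ≡ h j) → ∀ {e} → pdp g k m e → pdp h k m e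
pdp-local⁺ k m eq {e₀ , e₁} (p@(2≤e₀ , 2≤e₁) , q@(e₀≤k , e₁≤k) , r , s , t₀ , t₁) =
  p , q , r , s ,
  subst (λ x → [ m ]⁺ ≤⁺ x +∞ e₀) (eq (m≤n+m 1 (k ∸ e₀)) (k∸e+1<k 2≤e₀ e₀≤k)) t₀ ,
  subst (λ x → [ m ]⁺ ≤⁺ x +∞ e₁) (eq (m≤n+m 1 (k ∸ e₁)) (k∸e+1<k 2≤e₁ e₁≤k)) t₁

-- At `k`, `g` and `N∞` have the same admissible pairs, because these involve only values at
-- positive arguments below `k`. Hence `N k` is both admissible and an upper bound.
largest≡N : ∀ {g} k → 2 ≤ k → (∀ {j} → 1 ≤ j → j < k → g j ≡ N∞ j) → largest g k ≡ N k
largest≡N {g} k 2≤k eq = ≤-antisym (pdp-N⇒≤N (toN (proj₁ (proj₂ isLargest))))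
  (proj₂ (proj₂ isLargest) (N k) 4≤Nk Nk≤2k (fromN (pdp-N-N k 2≤k)))
  where
  toN : ∀ {m} → ∃ (pdp g k m) → ∃ (pdp N∞ k m)
  toN (e , p) = e , pdp-local⁺ k _ eq p
  fromN : ∀ {m} → ∃ (pdp N∞ k m) → ∃ (pdp g k m)
  fromN (e , p) = e , pdp-local⁺ k _ (λ 1≤j j<k → sym (eq 1≤j j<k)) p
  -- The pair realising `N k` has entries between 2 and `k`, so `N k` lies in the range searched by
  -- `largest`.
  4≤Nk : 4 ≤ N k
  4≤Nk with pdp-N-N k 2≤k
  ... | _ , (2≤e₀ , 2≤e₁) , _ , e₀+e₁≡ , _ = subst (4 ≤_) e₀+e₁≡ (+-mono-≤ 2≤e₀ 2≤e₁)
  Nk≤2k : N k ≤ 2 * k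
  Nk≤2k with pdp-N-N k 2≤k
  ... | _ , _ , (e₀≤k , e₁≤k) , e₀+e₁≡ , _ = subst₂ _≤_ e₀+e₁≡
    (cong (k +_) (sym (+-identityʳ k))) (+-mono-≤ e₀≤k e₁≤k)
  -- This makes `(2 , 2)` admissible for 4, so `largest` is a genuine maximum.
  2≤N[k-1] : 2 ≤ N (k ∸ 2 + 1)
  2≤N[k-1] = 2≤N (m≤n+m 1 (k ∸ 2))
  4≤ : [ 4 ]⁺ ≤⁺ N∞ (k ∸ 2 + 1) +∞ 2
  4≤ = [ +-monoˡ-≤ 2 2≤N[k-1] ]
  isLargest = largest-isLargest g k 2≤k
    (fromN ((2 , 2) , (≤-refl , ≤-refl) , (2≤k , 2≤k) , refl , ≤-refl , 4≤ , 4≤))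

-- The hypothesis says that `f` is at least `N` from 2 on. Both `[2]` and `N∞` satisfy it, so one
-- strong induction serves for both.
nM≡N∞ : ∀ f → (∀ k → 2 ≤ k → N k ⊓∞ f k ≡ N∞ k) → ∀ k → 1 ≤ k → nM f k ≡ N∞ k
nM≡N∞ f N⊓f≡N = <-rec (λ k → 1 ≤ k → nM f k ≡ N∞ k) λ where
  (suc zero)        _   _ → refl
  k@(suc (suc _)) rec _ → let 2≤k = s≤s (s≤s z≤n) in
    trans (nM-unfold f k)
      (trans (cong (_⊓∞ f k) (largest≡N k 2≤k (λ 1≤j j<k → rec j<k 1≤j))) (N⊓f≡N k 2≤k))

nM[2]≡N∞ : ∀ k → 1 ≤ k → nM [2] k ≡ N∞ k
nM[2]≡N∞ = nM≡N∞ [2] λ where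
  (suc zero)    (s≤s ())
  (suc (suc _)) _ → refl

nMN∞≡N∞ : ∀ k → 1 ≤ k → nM N∞ k ≡ N∞ k
nMN∞≡N∞ = nM≡N∞ N∞ λ k _ → cong [_]⁺ (⊓-idem (N k))

theorem13p15 : (∀ k → 1 ≤ k → nM [2] k ≡ nM N∞ k) × (∀ k → 1 ≤ k → nM N∞ k ≡ N∞ k)
theorem13p15 = (λ k 1≤k → trans (nM[2]≡N∞ k 1≤k) (sym (nMN∞≡N∞ k 1≤k))) , nMN∞≡N∞
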